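{- Let $n \ge 1$ be an integer and $d \ge 0$. For each real $x \ge 0$ let $h_1(x),\dots,h_n(x)$ be jointly distributed, discrete random variables with $0 \le h_i(x) \le x$, and let $S(x)$ be a real random variable. Let $b:[0,\infty)\to[0,\infty)$ satisfy $b(x)=0$ for $x\le d$ and $b(x)>0$ for $x>d$, and suppose that for $x>d$ the probabilistic recurrence $$S(x) = b(x) + \max_{i=1}^n S(h_i(x))$$ holds (as an identity of distributions, as explained in the context). Suppose that for every $x$ there is some $k$ such that the recurrence started from $x$ terminates after at most $k$ nested recursive calls, i.e. with probability one every chain of $k$ successive recursive calls started from $x$ reaches a size at most $d$. Let $g_1:\mathbb{R}\to[0,\infty)$ be a monotone (non-decreasing) function with $g_1(x)\ge 1$ for all $x>d$, such that for all $x>d$ and all $(y_1,\dots,y_n)$ in the support of the joint distribution of $(h_1(x),\dots,h_n(x))$ we have $\sum_{i=1}^n g_1(y_i)\le g_1(x)$. Let $m:[0,\infty)\to[0,\infty)$ satisfy $E\left[\max_{i=1}^n h_i(x)\right]\le m(x)$ and $0\le m(x)\le x$ for all $x$, with $m(x)/x$ non-decreasing on $(0,\infty)$. Let $u:[0,\infty)\to\mathbb{R}$ be a solution of the recurrence $$u(x)=b(x)+u(m(x)),$$ such that $u(x)=u(d)$ for all $x\le d$ and $S(x)\le u(x)$ almost surely for all $x\le d$. If $b$ and $u$ are continuous and $b$ is strictly increasing on the set $\{x \mid b(x)>0\}$, then for all positive integers $w$ and all $x>0$ such that $g_1(x)\ge 1$, $$\Pr\left[S(x)>u(x)+w\,b(x)\right]\le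 g_1(x)\left(\frac{m(x)}{x}\right)^w .$$
   Context: The probabilistic recurrence is a statement about distributions, not about random variables as functions on a sample space: for all $x>d$ and all $r\in\mathbb{R}$, $$\Pr[S(x)>r]=\sum_{y_1,\dots,y_n}\Pr\left[(h_1(x),\dots,h_n(x))=(y_1,\dots,y_n)\right]\cdot\Pr\left[\max_{i=1}^n S(y_i)>r-b(x)\right].$$ Here, in the last factor, $S(y_1),\dots,S(y_n)$ are taken on some common probability space with the given marginal laws; no independence is required. The function $b$ is called the toll function, and $d$ is the size at which the recursion stops. The termination assumption says: for every $x$ there is $k$ such that whenever $x=x_0,x_1,\dots,x_k$ is a sequence in which each $x_{j+1}$ is a value taken with positive probability by some $h_i(x_j)$, we have $x_k\le d$. -}

module Defs where

open import Algebra.Bundles using (CommutativeRing; Semiring)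
open import Algebra.Structures using (IsCommutativeRing)
import Algebra.Construct.NaturalChoice.Max as NaturalMax
import Algebra.Definitions.RawSemiring as RawSemiringOps
open import Data.Fin.Base using (Fin)
open import Data.List.Base using (List; map; foldr)
open import Data.List.Relation.Unary.Unique.Propositional using (Unique)
open import Data.Nat.Base as ℕ using (ℕ; zero; suc; NonZero)
open import Data.Product.Base using (∃; ∃-syntax; Σ-syntax; _×_)
open import Data.Vec.Base as Vec using (Vec; lookup; tabulate; foldr₁)
open import Level using (0ℓ)
open import Relation.Binary.Bundles using (TotalOrder)
import Relation.Binary.Construct.NonStrictToStrict as ToStrict
open import Relation.Binary.PropositionalEquality using (_≡_; _≢_)
open import Relation.Binary.Structures using (IsTotalOrder)
open import Relation.Nullary.Negation using (¬_)
open import Relation.Unary using (Pred; U; ∁; ⋃; _≐_)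

-- The real numbers enter as an arbitrary Dedekind-complete ordered field,
-- which classically determines them up to unique isomorphism.
record RealNumbers : Set₁ where
  infix  4 _≤_
  infixl 6 _+_
  infixl 7 _*_
  infix  8 -_
  infix  9 _⁻¹
  field
    ℝ                 : Set
    _≤_               : ℝ → ℝ → Set
    _+_ _*_           : ℝ → ℝ → ℝ
    -_                : ℝ → ℝ
    0# 1#             : ℝ
    -- Total; the value at 0 is unconstrained.
    _⁻¹               : ℝ → ℝ
    isCommutativeRing : IsCommutativeRing _≡_ _+_ _*_ -_ 0# 1#
    isTotalOrder      : IsTotalOrder _≡_ _≤_
    0≢1               : 0# ≢ 1#
    ⁻¹-inverseʳ       : ∀ x → x ≢ 0# → x * x ⁻¹ ≡ 1#
    +-monoˡ-≤         : ∀ z {x y} → x ≤ y → x + z ≤ y + z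
    *-nonNeg          : ∀ {x y} → 0# ≤ x → 0# ≤ y → 0# ≤ x * y

  UpperBound : Pred ℝ 0ℓ → ℝ → Set
  UpperBound P b = ∀ x → P x → x ≤ b

  IsSupremum : Pred ℝ 0ℓ → ℝ → Set
  IsSupremum P s = UpperBound P s × (∀ b → UpperBound P b → s ≤ b)

  field
    complete : (P : Pred ℝ 0ℓ) → ∃ P → ∃ (UpperBound P) → ∃ (IsSupremum P)

  commutativeRing : CommutativeRing 0ℓ 0ℓ
  commutativeRing = record { isCommutativeRing = isCommutativeRing }

  totalOrder : TotalOrder 0ℓ 0ℓ 0ℓ
  totalOrder = record { isTotalOrder = isTotalOrder }

module Probability (reals : RealNumbers) where

  open RealNumbers reals public

  open ToStrict _≡_ _≤_ public using (_<_)
  open NaturalMax totalOrder public using (_⊔_)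
  open RawSemiringOps (Semiring.rawSemiring (CommutativeRing.semiring commutativeRing)) public
    using (_^_) renaming (_×_ to _·_)

  infix  4 _>_ _≥_
  infixl 6 _-_
  infixl 7 _/_

  _>_ _≥_ : ℝ → ℝ → Set
  x > y = y < x
  x ≥ y = y ≤ x

  _-_ _/_ : ℝ → ℝ → ℝ
  x - y = x + (- y)
  x / y = x * y ⁻¹

  ∣_∣ : ℝ → ℝ
  ∣ x ∣ = x ⊔ (- x)

  maximum : ∀ {n} .{{_ : NonZero n}} → Vec ℝ n → ℝ
  maximum {suc _} = foldr₁ _⊔_

  total : ∀ {n} → Vec ℝ n → ℝ
  total = Vec.foldr′ _+_ 0#

  ContinuousOnNonNeg : (ℝ → ℝ) → Set
  ContinuousOnNonNeg f =
    ∀ x → x ≥ 0# → ∀ ε → ε > 0# →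
    ∃[ δ ] (δ > 0# ×
            (∀ y → y ≥ 0# → ∣ y - x ∣ < δ → ∣ f y - f x ∣ < ε))

  -- Unordered sum, over an arbitrary index type, of a family of
  -- non-negative reals: the supremum of its finite partial sums.
  FinitePartialSum : {I : Set} → (I → ℝ) → Pred ℝ 0ℓ
  FinitePartialSum {I} f s =
    Σ[ is ∈ List I ] (Unique is × s ≡ foldr _+_ 0# (map f is))

  HasSum : {I : Set} → (I → ℝ) → ℝ → Set
  HasSum f = IsSupremum (FinitePartialSum f)

  record ProbabilitySpace : Set₁ where
    field
      Ω            : Set
      Measurable   : Pred Ω 0ℓ → Set
      -- Total; the values at non-measurable sets are unconstrained.
      Pr           : Pred Ω 0ℓ → ℝ

      -- Without predicate extensionality, events have to be identified
      -- up to mutual inclusion explicitly.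
      measurable-≐ : ∀ {A B} → A ≐ B → Measurable A → Measurable B
      measurable-U : Measurable U
      measurable-∁ : ∀ {A} → Measurable A → Measurable (∁ A)
      measurable-⋃ : ∀ (A : ℕ → Pred Ω 0ℓ) → (∀ k → Measurable (A k)) →
                     Measurable (⋃ ℕ A)

      Pr-≐         : ∀ {A B} → A ≐ B → Measurable A → Pr A ≡ Pr B
      Pr-nonNeg    : ∀ {A} → Measurable A → Pr A ≥ 0#
      Pr-U         : Pr U ≡ 1#
      Pr-⋃         : ∀ (A : ℕ → Pred Ω 0ℓ) → (∀ k → Measurable (A k)) →
                     (∀ j k → j ≢ k → ∀ ω → ¬ (A j ω × A k ω)) →
                     HasSum (λ k → Pr (A k)) (Pr (⋃ ℕ A))

  record RandomVariableOn (space : ProbabilitySpace) : Set where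
    open ProbabilitySpace space
    field
      value      : Ω → ℝ
      measurable : ∀ r → Measurable (λ ω → value ω > r)

  record RandomVariable : Set₁ where
    field
      space : ProbabilitySpace
      var   : RandomVariableOn space
    open ProbabilitySpace space public
    open RandomVariableOn var public

  Pr[_>_] : RandomVariable → ℝ → ℝ
  Pr[ X > r ] = Pr (λ ω → value ω > r)
    where open RandomVariable X

  AlmostSurely[_≤_] : RandomVariable → ℝ → Set
  AlmostSurely[ X ≤ r ] = Pr (λ ω → value ω ≤ r) ≡ 1#
    where open RandomVariable X

  -- Equality of the tail functions, i.e. of the laws on Borel sets.
  _≈ᵈ_ : RandomVariable → RandomVariable → Set
  X ≈ᵈ Y = ∀ r → Pr[ X > r ] ≡ Pr[ Y > r ]

  -- The joint law of n discrete random variables; that the masses sum to 1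
  -- forces the support to be countable.
  record DiscreteLaw (n : ℕ) : Set where
    field
      mass        : Vec ℝ n → ℝ
      mass-nonNeg : ∀ y → mass y ≥ 0#
      mass-sum    : HasSum mass 1#

    Support : Pred (Vec ℝ n) 0ℓ
    Support y = mass y > 0#

  -- The expectation of f(Y), for Y distributed according to the given law
  -- and f non-negative on its support.
  HasExpectation : ∀ {n} → DiscreteLaw n → (Vec ℝ n → ℝ) → ℝ → Set
  HasExpectation law f = HasSum (λ y → DiscreteLaw.mass law y * f y)

  module _ (S : ℝ → RandomVariable) where

    -- Copies of S(y₁),…,S(yₙ) on a common probability space, with no
    -- restriction on their joint law.
    record Coupling {n} (y : Vec ℝ n) : Set₁ where
      field
        space    : ProbabilitySpace
        var      : Fin n → RandomVariableOn space
        marginal : ∀ i → record { var = var i } ≈ᵈ S (lookup y i)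

    Pr[max_>_] : ∀ {n} .{{_ : NonZero n}} {y : Vec ℝ n} →
                 Coupling y → ℝ → ℝ
    Pr[max C > r ] =
      Pr (λ ω → maximum (tabulate (λ i → value (var i) ω)) > r)
      where
      open Coupling C
      open ProbabilitySpace space
      open RandomVariableOn

    -- S(x) = b + maxᵢ S(hᵢ(x)) in distribution. Tuples outside the support
    -- contribute 0, whatever coupling is chosen for them.
    SatisfiesRecurrence : ∀ {n} .{{_ : NonZero n}} →
                          DiscreteLaw n → ℝ → ℝ → Set₁
    SatisfiesRecurrence {n} h b x =
      Σ[ C ∈ ((y : Vec ℝ n) → Coupling y) ]
        (∀ r → HasSum (λ y → mass y * Pr[max C y > r - b ])
                      Pr[ S x > r ])
      where open DiscreteLaw h

  module _ {n} (h : ℝ → DiscreteLaw n) where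

    open DiscreteLaw

    -- z is a value taken with positive probability by some hᵢ(x).
    Calls : ℝ → ℝ → Set
    Calls x z = ∃[ y ] (Support (h x) y × ∃[ i ] (z ≡ lookup y i))

    TerminatesWithin : ℝ → ℝ → ℕ → Set
    TerminatesWithin d x k =
      ∀ (s : ℕ → ℝ) → s 0 ≡ x →
      (∀ j → j ℕ.< k → Calls (s j) (s (suc j))) → s k ≤ d

{-# OPTIONS --safe #-}
-- With ρ x = m x / x, one bounds, for every size x > d and by induction on the
-- recursion depth, all tails Pr[ S x > u q + w · b x ] at once by
-- g₁ x · ρ x ^ w · x / q, where q is an arbitrary positive point; the theorem is
-- the case q = x. The union bound over the recursive calls and Σ g₁ yᵢ ≤ g₁ x
-- turn a bound g₁ y · y · K for the calls, K independent of y, into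
-- g₁ x · m x · K for x. For w > 0 one takes K = ρ x ^ (w - 1) / q. For w = 0 and
-- q > x, the remaining level u q - b x is at least u (m q), so K = 1 / m q, and
-- m x / m q ≤ x / q because ρ is monotone; for w = 0 and q ≤ x the bound is
-- trivial. Calls of size at most d never exceed u d, which is the minimum of u.

module Submission where

open import Defs
open import Algebra.Bundles using (CommutativeRing)
import Algebra.Construct.NaturalChoice.Max as NaturalMax
import Algebra.Properties.Group as GroupProperties
import Algebra.Properties.Ring as RingProperties
import Algebra.Solver.Ring.NaturalCoefficients.Default as SemiringSolver
open import Axiom.ExcludedMiddle using (ExcludedMiddle)
open import Data.Empty using (⊥-elim)
open import Data.Fin.Base as Fin using (Fin)
open import Data.List.Base as List using (List; []; _∷_; foldr)
open import Data.List.Relation.Unary.All as All using (All; []; _∷_)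
open import Data.List.Relation.Unary.AllPairs using ([]; _∷_)
open import Data.List.Relation.Unary.Unique.Propositional using (Unique)
open import Data.Nat.Base as ℕ using (ℕ; zero; suc; NonZero; s≤s; ≢-nonZero⁻¹)
open import Data.Product.Base using (∃-syntax; _×_; _,_; proj₁; proj₂)
open import Data.Sum.Base using (_⊎_; inj₁; inj₂; [_,_]′)
open import Data.Unit.Base using (tt)
open import Data.Vec.Base using (Vec; []; _∷_; lookup; map; tabulate)
open import Level using (0ℓ)
open import Relation.Binary.Bundles using (TotalOrder)
import Relation.Binary.Construct.NonStrictToStrict as ToStrict
import Relation.Binary.Reasoning.PartialOrder as ≤-Reasoning
open import Relation.Binary.PropositionalEquality using (_≡_; _≢_; refl; sym; trans; cong; cong₂; subst)
open import Relation.Nullary using (¬_; yes; no)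
open import Relation.Unary using (Pred; ∁; ⋃; _≐_; _⊆_; _∪_; _∩_; ∅)

module _ (em : ExcludedMiddle 0ℓ) (reals : RealNumbers) where

  open Probability reals
  open CommutativeRing commutativeRing
    using (+-group; +-comm; +-assoc; +-identityˡ; +-identityʳ; -‿inverseˡ; -‿inverseʳ
          ; *-comm; *-assoc; *-identityˡ; *-identityʳ; zeroˡ; zeroʳ
          ; distribˡ; distribʳ; ring; commutativeSemiring)
  open GroupProperties +-group using (⁻¹-anti-homo-//)
  open RingProperties ring
    using (-‿distribˡ-*; -‿involutive; -0#≈0#)
  open TotalOrder totalOrder
    using (poset; antisym)
    renaming (refl to ≤-refl; trans to ≤-trans; reflexive to ≤-reflexive)
  open NaturalMax totalOrder using (⊔-sel; x≤x⊔y; x≤y⊔x)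
  open SemiringSolver commutativeSemiring using (solve; _:=_; _:+_; _:*_)
  open ≤-Reasoning poset
  private
    module Order = TotalOrder totalOrder

  -- Arithmetic of an ordered field.

  <⇒≱ : ∀ {x y} → x < y → ¬ y ≤ x
  <⇒≱ = ToStrict.<⇒≱ _≡_ _≤_ antisym

  ≰⇒> : ∀ {x y} → ¬ x ≤ y → y < x
  ≰⇒> = ToStrict.≰⇒> _≡_ _≤_ sym ≤-reflexive Order.total

  ≮⇒≥ : ∀ {x y} → ¬ x < y → y ≤ x
  ≮⇒≥ {x} {y} x≮y with em {y ≤ x}
  ... | yes y≤x = y≤x
  ... | no  y≰x = ⊥-elim (x≮y (≰⇒> y≰x))

  ≤-<-connex : ∀ x y → x ≤ y ⊎ y < x
  ≤-<-connex x y with em {x ≤ y}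
  ... | yes x≤y = inj₁ x≤y
  ... | no  x≰y = inj₂ (≰⇒> x≰y)

  ≤-<-trans : ∀ {x y z} → x ≤ y → y < z → x < z
  ≤-<-trans x≤y y<z = ≰⇒> λ z≤x → <⇒≱ y<z (≤-trans z≤x x≤y)

  <-≤-trans : ∀ {x y z} → x < y → y ≤ z → x < z
  <-≤-trans x<y y≤z = ≰⇒> λ z≤x → <⇒≱ x<y (≤-trans y≤z z≤x)

  +-monoʳ-≤ : ∀ z {x y} → x ≤ y → z + x ≤ z + y
  +-monoʳ-≤ z {x} {y} x≤y = begin
    z + x  ≡⟨ +-comm z x ⟩
    x + z  ≤⟨ +-monoˡ-≤ z x≤y ⟩
    y + z  ≡⟨ +-comm y z ⟩
    z + y  ∎

  +-mono-≤ : ∀ {x y z w} → x ≤ y → z ≤ w → x + z ≤ y + w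
  +-mono-≤ x≤y z≤w = ≤-trans (+-monoˡ-≤ _ x≤y) (+-monoʳ-≤ _ z≤w)

  x≡0⇒x+y≡y : ∀ {x y} → x ≡ 0# → x + y ≡ y
  x≡0⇒x+y≡y {y = y} x≡0 = trans (cong (_+ y) x≡0) (+-identityˡ y)

  x+y-y≡x : ∀ x y → x + y - y ≡ x
  x+y-y≡x x y = trans (+-assoc x y (- y)) (trans (cong (x +_) (-‿inverseʳ y)) (+-identityʳ x))

  x-y+y≡x : ∀ x y → x - y + y ≡ x
  x-y+y≡x x y = trans (+-assoc x (- y) y) (trans (cong (x +_) (-‿inverseˡ y)) (+-identityʳ x))

  +-cancelʳ-≤ : ∀ z {x y} → x + z ≤ y + z → x ≤ y
  +-cancelʳ-≤ z {x} {y} p = begin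
    x          ≡⟨ x+y-y≡x x z ⟨
    x + z - z  ≤⟨ +-monoˡ-≤ (- z) p ⟩
    y + z - z  ≡⟨ x+y-y≡x y z ⟩
    y          ∎

  x+y≤z⇒x≤z-y : ∀ {x y z} → x + y ≤ z → x ≤ z - y
  x+y≤z⇒x≤z-y {x} {y} {z} p = +-cancelʳ-≤ y (≤-trans p (≤-reflexive (sym (x-y+y≡x z y))))

  x≤z-y⇒x+y≤z : ∀ {x y z} → x ≤ z - y → x + y ≤ z
  x≤z-y⇒x+y≤z {x} {y} {z} p = ≤-trans (+-monoˡ-≤ y p) (≤-reflexive (x-y+y≡x z y))

  x≤y⇒0≤y-x : ∀ {x y} → x ≤ y → 0# ≤ y - x
  x≤y⇒0≤y-x {x} x≤y = x+y≤z⇒x≤z-y (≤-trans (≤-reflexive (+-identityˡ x)) x≤y)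

  x<y⇒0<y-x : ∀ {x y} → x < y → 0# < y - x
  x<y⇒0<y-x {x} {y} x<y = ≰⇒> λ p → <⇒≱ x<y (begin
    y          ≡⟨ x-y+y≡x y x ⟨
    y - x + x  ≤⟨ +-monoˡ-≤ x p ⟩
    0# + x     ≡⟨ +-identityˡ x ⟩
    x          ∎)

  neg-≤ : ∀ {x y} → x ≤ y → - y ≤ - x
  neg-≤ {x} {y} x≤y = begin
    - y              ≡⟨ +-identityˡ (- y) ⟨
    0# - y           ≤⟨ +-monoˡ-≤ (- y) (x≤y⇒0≤y-x x≤y) ⟩
    y - x - y        ≡⟨ cong (_- y) (+-comm y (- x)) ⟩
    - x + y - y      ≡⟨ x+y-y≡x (- x) y ⟩
    - x              ∎

  ∣x∣<δ : ∀ {x δ} → x < δ → - x < δ → ∣ x ∣ < δ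
  ∣x∣<δ {x} {δ} x<δ -x<δ with ⊔-sel x (- x)
  ... | inj₁ eq = subst (_< δ) (sym eq) x<δ
  ... | inj₂ eq = subst (_< δ) (sym eq) -x<δ

  *-monoˡ-≤ : ∀ {z x y} → 0# ≤ z → x ≤ y → z * x ≤ z * y
  *-monoˡ-≤ {z} {x} {y} 0≤z x≤y = begin
    z * x                ≡⟨ +-identityˡ (z * x) ⟨
    0# + z * x           ≤⟨ +-monoˡ-≤ (z * x) (*-nonNeg 0≤z (x≤y⇒0≤y-x x≤y)) ⟩
    z * (y - x) + z * x  ≡⟨ distribˡ z (y - x) x ⟨
    z * (y - x + x)      ≡⟨ cong (z *_) (x-y+y≡x y x) ⟩
    z * y                ∎

  *-monoʳ-≤ : ∀ {z x y} → 0# ≤ z → x ≤ y → x * z ≤ y * z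
  *-monoʳ-≤ {z} {x} {y} 0≤z x≤y = begin
    x * z  ≡⟨ *-comm x z ⟩
    z * x  ≤⟨ *-monoˡ-≤ 0≤z x≤y ⟩
    z * y  ≡⟨ *-comm z y ⟩
    y * z  ∎

  -- If `1#` lay below `0#`, then `- 1#` would be non-negative, and `1#` is its square.
  0≤1 : 0# ≤ 1#
  0≤1 with Order.total 0# 1#
  ... | inj₁ p = p
  ... | inj₂ 1≤0 = ≤-trans (*-nonNeg 0≤-1 0≤-1) (≤-reflexive -1*-1≡1)
    where
    0≤-1 : 0# ≤ - 1#
    0≤-1 = ≤-trans (x≤y⇒0≤y-x 1≤0) (≤-reflexive (+-identityˡ (- 1#)))
    -1*-1≡1 : - 1# * - 1# ≡ 1#
    -1*-1≡1 = trans (sym (-‿distribˡ-* 1# (- 1#)))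
                    (trans (cong -_ (*-identityˡ (- 1#))) (-‿involutive 1#))

  0<x⇒0≤x⁻¹ : ∀ {x} → 0# < x → 0# ≤ x ⁻¹
  0<x⇒0≤x⁻¹ {x} (0≤x , 0≢x) with Order.total 0# (x ⁻¹)
  ... | inj₁ p = p
  ... | inj₂ x⁻¹≤0 = ⊥-elim (0≢1 (antisym 0≤1 (begin
    1#        ≡⟨ ⁻¹-inverseʳ x (λ x≡0 → 0≢x (sym x≡0)) ⟨
    x * x ⁻¹  ≤⟨ *-monoˡ-≤ 0≤x x⁻¹≤0 ⟩
    x * 0#    ≡⟨ zeroʳ x ⟩
    0#        ∎)))

  ⁻¹-inverseˡ : ∀ {x} → 0# < x → x ⁻¹ * x ≡ 1#
  ⁻¹-inverseˡ {x} (_ , 0≢x) = trans (*-comm (x ⁻¹) x) (⁻¹-inverseʳ x (λ x≡0 → 0≢x (sym x≡0)))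

  0≤x^n : ∀ {x} → 0# ≤ x → ∀ n → 0# ≤ x ^ n
  0≤x^n 0≤x zero    = 0≤1
  0≤x^n 0≤x (suc n) = *-nonNeg 0≤x (0≤x^n 0≤x n)

  ^-mono-≤ : ∀ {x y} → 0# ≤ x → x ≤ y → ∀ n → x ^ n ≤ y ^ n
  ^-mono-≤ 0≤x x≤y zero    = ≤-refl
  ^-mono-≤ 0≤x x≤y (suc n) =
    ≤-trans (*-monoˡ-≤ 0≤x (^-mono-≤ 0≤x x≤y n))
            (*-monoʳ-≤ (0≤x^n (≤-trans 0≤x x≤y) n) x≤y)

  ·-monoʳ-≤ : ∀ n {x y} → x ≤ y → n · x ≤ n · y
  ·-monoʳ-≤ zero    x≤y = ≤-refl
  ·-monoʳ-≤ (suc n) x≤y = +-mono-≤ x≤y (·-monoʳ-≤ n x≤y)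

  0≤n·x : ∀ n {x} → 0# ≤ x → 0# ≤ n · x
  0≤n·x zero    0≤x = ≤-refl
  0≤n·x (suc n) 0≤x = ≤-trans (≤-reflexive (sym (+-identityˡ 0#))) (+-mono-≤ 0≤x (0≤n·x n 0≤x))

  lookup≤maximum : ∀ {n} .{{_ : NonZero n}} (y : Vec ℝ n) i → lookup y i ≤ maximum y
  lookup≤maximum (x ∷ [])     Fin.zero    = ≤-refl
  lookup≤maximum (x ∷ y ∷ ys) Fin.zero    = x≤x⊔y _ _
  lookup≤maximum (x ∷ y ∷ ys) (Fin.suc i) = ≤-trans (lookup≤maximum (y ∷ ys) i) (x≤y⊔x x _)

  -- Comparison of unordered sums.

  -- `c * t` bounds every finite partial sum of `f`, by comparison with the partial sum of `g` over
  -- the same list, and `s` is the least such bound.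
  HasSum-scale-≤ : ∀ {I : Set} {f g : I → ℝ} {s t c} → 0# ≤ c →
                   (∀ i → f i ≤ c * g i) → HasSum f s → HasSum g t → s ≤ c * t
  HasSum-scale-≤ {I} {f} {g} {s} {t} {c} 0≤c f≤cg (_ , least) (upper , _) =
    least (c * t) λ { _ (is , uniq , refl) →
      ≤-trans (partial is) (*-monoˡ-≤ 0≤c (upper _ (is , uniq , refl))) }
    where
    partial : ∀ is → foldr _+_ 0# (List.map f is) ≤ c * foldr _+_ 0# (List.map g is)
    partial []       = ≤-reflexive (sym (zeroʳ c))
    partial (i ∷ is) = ≤-trans (+-mono-≤ (f≤cg i) (partial is)) (≤-reflexive (sym (distribˡ c _ _)))

  HasSum-term-≤ : ∀ {I : Set} {f : I → ℝ} {s} → HasSum f s → ∀ i → f i ≤ s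
  HasSum-term-≤ {f = f} (upper , _) i =
    ≤-trans (≤-reflexive (sym (+-identityʳ (f i)))) (upper _ (i ∷ [] , [] ∷ [] , refl))

  module _ (f : ℕ → ℝ) (f-nonNeg : ∀ k → 0# ≤ f k) where

    private
      Σf : List ℕ → ℝ
      Σf is = foldr _+_ 0# (List.map f is)

    sum-vanishing : ∀ {is} → All (λ k → f k ≡ 0#) is → Σf is ≡ 0#
    sum-vanishing []       = refl
    sum-vanishing (p ∷ ps) = trans (cong₂ _+_ p (sum-vanishing ps)) (+-identityˡ 0#)

    -- A duplicate-free list meets `j` at most once; after that occurrence every remaining term
    -- vanishes.
    sum≤one-term : ∀ j {is} → Unique is → All (λ k → k ≡ j ⊎ f k ≡ 0#) is → Σf is ≤ f j
    sum≤one-term j []           []                = f-nonNeg j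
    sum≤one-term j (x∉is ∷ _)   (inj₁ refl ∷ ps)  =
      ≤-reflexive (trans (cong (f j +_) (sum-vanishing (All.zipWith absent (x∉is , ps)))) (+-identityʳ (f j)))
      where
      absent : ∀ {k} → (j ≢ k) × (k ≡ j ⊎ f k ≡ 0#) → f k ≡ 0#
      absent (j≢k , inj₁ k≡j)  = ⊥-elim (j≢k (sym k≡j))
      absent (_   , inj₂ fk≡0) = fk≡0
    sum≤one-term j (_ ∷ uniq)   (inj₂ fx≡0 ∷ ps)  =
      ≤-trans (≤-reflexive (x≡0⇒x+y≡y fx≡0)) (sum≤one-term j uniq ps)

    -- Serves to evaluate the countable sum for a sequence padded with empty events. Whichever of
    -- the indices 0 and 1 occurs first is split off, and `sum≤one-term` handles what follows it.
    sum≤two-terms : (∀ k → f (2 ℕ.+ k) ≡ 0#) → ∀ {is} → Unique is → Σf is ≤ f 0 + f 1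
    sum≤two-terms tail≡0 [] =
      ≤-trans (≤-reflexive (sym (+-identityˡ 0#))) (+-mono-≤ (f-nonNeg 0) (f-nonNeg 1))
    sum≤two-terms tail≡0 (_∷_ {zero} 0∉is uniq) =
      +-monoʳ-≤ (f 0) (sum≤one-term 1 uniq (All.map other 0∉is))
      where
      other : ∀ {k} → 0 ≢ k → k ≡ 1 ⊎ f k ≡ 0#
      other {zero}        0≢0 = ⊥-elim (0≢0 refl)
      other {suc zero}    _   = inj₁ refl
      other {suc (suc k)} _   = inj₂ (tail≡0 k)
    sum≤two-terms tail≡0 (_∷_ {suc zero} 1∉is uniq) =
      ≤-trans (+-monoʳ-≤ (f 1) (sum≤one-term 0 uniq (All.map other 1∉is))) (≤-reflexive (+-comm (f 1) (f 0)))
      where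
      other : ∀ {k} → 1 ≢ k → k ≡ 0 ⊎ f k ≡ 0#
      other {zero}        _   = inj₁ refl
      other {suc zero}    1≢1 = ⊥-elim (1≢1 refl)
      other {suc (suc k)} _   = inj₂ (tail≡0 k)
    sum≤two-terms tail≡0 (_∷_ {suc (suc k)} _ uniq) =
      ≤-trans (≤-reflexive (x≡0⇒x+y≡y (tail≡0 k))) (sum≤two-terms tail≡0 uniq)

  -- Finite additivity and the union bound.

  module _ (P : ProbabilitySpace) where

    open ProbabilitySpace P

    measurable-∅ : Measurable ∅
    measurable-∅ = measurable-≐ ((λ ¬tt → ¬tt tt) , λ ()) (measurable-∁ measurable-U)

    -- The constant sequence of empty events is pairwise disjoint with empty union, so its partial
    -- sum over the indices 0 and 1 gives `Pr ∅ + Pr ∅ ≤ Pr ∅`.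
    Pr-∅ : Pr ∅ ≡ 0#
    Pr-∅ = antisym (+-cancelʳ-≤ (Pr ∅) p+p≤0+p) (Pr-nonNeg measurable-∅)
      where
      p+p≤0+p : Pr ∅ + Pr ∅ ≤ 0# + Pr ∅
      p+p≤0+p = begin
        Pr ∅ + Pr ∅         ≡⟨ cong (Pr ∅ +_) (+-identityʳ (Pr ∅)) ⟨
        Pr ∅ + (Pr ∅ + 0#)  ≤⟨ proj₁ (Pr-⋃ (λ _ → ∅) (λ _ → measurable-∅) (λ _ _ _ _ ()))
                                  _ (0 ∷ 1 ∷ [] , ((λ ()) ∷ []) ∷ [] ∷ [] , refl) ⟩
        Pr (⋃ ℕ (λ _ → ∅))  ≡⟨ Pr-≐ ((λ ()) , λ ()) (measurable-⋃ _ (λ _ → measurable-∅)) ⟩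
        Pr ∅                ≡⟨ +-identityˡ (Pr ∅) ⟨
        0# + Pr ∅           ∎

    module _ (A B : Pred Ω 0ℓ) where

      -- Padding with `∅` turns the countable axioms into statements about two events.
      pair : ℕ → Pred Ω 0ℓ
      pair 0             = A
      pair 1             = B
      pair (suc (suc _)) = ∅

      ⋃-pair : ⋃ ℕ pair ≐ A ∪ B
      ⋃-pair = (λ { (0 , a) → inj₁ a ; (1 , b) → inj₂ b ; (suc (suc _) , ()) })
             , (λ { (inj₁ a) → 0 , a ; (inj₂ b) → 1 , b })

    module _ {A B : Pred Ω 0ℓ} (mA : Measurable A) (mB : Measurable B) where

      measurable-pair : ∀ k → Measurable (pair A B k)
      measurable-pair 0             = mA
      measurable-pair 1             = mB
      measurable-pair (suc (suc _)) = measurable-∅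

      measurable-∪ : Measurable (A ∪ B)
      measurable-∪ = measurable-≐ (⋃-pair A B) (measurable-⋃ _ measurable-pair)

      -- For the upper bound, any partial sum has at most two nonzero terms; the lower bound is the
      -- partial sum over the indices 0 and 1.
      Pr-∪-disjoint : (∀ ω → ¬ (A ω × B ω)) → Pr (A ∪ B) ≡ Pr A + Pr B
      Pr-∪-disjoint disjoint = trans (sym (Pr-≐ (⋃-pair A B) (measurable-⋃ _ measurable-pair)))
        (antisym
          (proj₂ hasSum _ λ { _ (_ , uniq , refl) →
            sum≤two-terms (λ k → Pr (pair A B k)) (λ k → Pr-nonNeg (measurable-pair k)) (λ _ → Pr-∅) uniq })
          (≤-trans (≤-reflexive (cong (Pr A +_) (sym (+-identityʳ (Pr B)))))
            (proj₁ hasSum _ (0 ∷ 1 ∷ [] , ((λ ()) ∷ []) ∷ [] ∷ [] , refl))))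
        where
        pairwise : ∀ j k → j ≢ k → ∀ ω → ¬ (pair A B j ω × pair A B k ω)
        pairwise 0 0 0≢0 _ _ = 0≢0 refl
        pairwise 0 1 _   ω (a , b) = disjoint ω (a , b)
        pairwise 1 0 _   ω (b , a) = disjoint ω (a , b)
        pairwise 1 1 1≢1 _ _ = 1≢1 refl
        pairwise 0 (suc (suc _)) _ _ (_ , ())
        pairwise 1 (suc (suc _)) _ _ (_ , ())
        pairwise (suc (suc _)) _ _ _ (() , _)

        hasSum : HasSum (λ k → Pr (pair A B k)) (Pr (⋃ ℕ (pair A B)))
        hasSum = Pr-⋃ (pair A B) measurable-pair pairwise

    measurable-∖ : ∀ {A B} → Measurable A → Measurable B → Measurable (B ∩ ∁ A)
    measurable-∖ {A} {B} mA mB =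
      measurable-≐ (to , λ { (b , ¬a) → [ (λ ¬b → ¬b b) , ¬a ]′ }) (measurable-∁ (measurable-∪ (measurable-∁ mB) mA))
      where
      to : ∁ (∁ B ∪ A) ⊆ B ∩ ∁ A
      to {ω} ¬[¬b∪a] with em {B ω}
      ... | yes b  = b , λ a → ¬[¬b∪a] (inj₂ a)
      ... | no  ¬b = ⊥-elim (¬[¬b∪a] (inj₁ ¬b))

    Pr-∪-∖ : ∀ {A B} → Measurable A → Measurable B → Pr (A ∪ B) ≡ Pr A + Pr (B ∩ ∁ A)
    Pr-∪-∖ {A} {B} mA mB =
      trans (Pr-≐ (split , [ inj₁ , (λ { (b , _) → inj₂ b }) ]′) (measurable-∪ mA mB))
            (Pr-∪-disjoint mA (measurable-∖ mA mB) (λ { _ (a , _ , ¬a) → ¬a a }))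
      where
      split : A ∪ B ⊆ A ∪ (B ∩ ∁ A)
      split (inj₁ a) = inj₁ a
      split {ω} (inj₂ b) with em {A ω}
      ... | yes a  = inj₁ a
      ... | no  ¬a = inj₂ (b , ¬a)

    Pr-mono : ∀ {A B} → Measurable A → Measurable B → A ⊆ B → Pr A ≤ Pr B
    Pr-mono {A} {B} mA mB A⊆B = begin
      Pr A                  ≡⟨ +-identityʳ (Pr A) ⟨
      Pr A + 0#             ≤⟨ +-monoʳ-≤ (Pr A) (Pr-nonNeg (measurable-∖ mA mB)) ⟩
      Pr A + Pr (B ∩ ∁ A)   ≡⟨ Pr-∪-∖ mA mB ⟨
      Pr (A ∪ B)            ≡⟨ Pr-≐ ([ A⊆B , (λ b → b) ]′ , inj₂) (measurable-∪ mA mB) ⟩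
      Pr B                  ∎

    Pr-∪-≤ : ∀ {A B} → Measurable A → Measurable B → Pr (A ∪ B) ≤ Pr A + Pr B
    Pr-∪-≤ {A} {B} mA mB =
      ≤-trans (≤-reflexive (Pr-∪-∖ mA mB)) (+-monoʳ-≤ (Pr A) (Pr-mono (measurable-∖ mA mB) mB proj₁))

    Pr≤1 : ∀ {A} → Measurable A → Pr A ≤ 1#
    Pr≤1 mA = ≤-trans (Pr-mono mA measurable-U (λ _ → tt)) (≤-reflexive Pr-U)

    -- The union bound. Measurability is proved in the same induction because `Pr-∪-≤` asks for it
    -- at the tail event.
    Pr[max]≤total : ∀ {n} .{{_ : NonZero n}} (X : Fin n → RandomVariableOn P) r →
      let open RandomVariableOn
          max>r = λ ω → maximum (tabulate (λ i → value (X i) ω)) > r in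
      Measurable max>r × Pr max>r ≤ total (tabulate (λ i → Pr (λ ω → value (X i) ω > r)))
    Pr[max]≤total {zero} _ _ = ⊥-elim (≢-nonZero⁻¹ 0 refl)
    Pr[max]≤total {suc zero} X r =
      RandomVariableOn.measurable (X Fin.zero) r , ≤-reflexive (sym (+-identityʳ _))
    Pr[max]≤total {suc (suc n)} X r with Pr[max]≤total (λ i → X (Fin.suc i)) r
    ... | mTail , tail≤ =
      measurable-≐ ∪≐max (measurable-∪ mHead mTail) ,
      (begin
        Pr max>r                ≡⟨ Pr-≐ ∪≐max (measurable-∪ mHead mTail) ⟨
        Pr (head>r ∪ tail>r)    ≤⟨ Pr-∪-≤ mHead mTail ⟩
        Pr head>r + Pr tail>r   ≤⟨ +-monoʳ-≤ _ tail≤ ⟩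
        _                       ∎)
      where
      open RandomVariableOn
      head>r tail>r max>r : Pred Ω 0ℓ
      head>r ω = value (X Fin.zero) ω > r
      tail>r ω = maximum (tabulate (λ i → value (X (Fin.suc i)) ω)) > r
      max>r  ω = maximum (tabulate (λ i → value (X i) ω)) > r
      mHead : Measurable head>r
      mHead = measurable (X Fin.zero) r
      ∪≐max : head>r ∪ tail>r ≐ max>r
      ∪≐max = [ (λ p → <-≤-trans p (x≤x⊔y _ _)) , (λ p → <-≤-trans p (x≤y⊔x _ _)) ]′ , from
        where
        from : max>r ⊆ head>r ∪ tail>r
        from {ω} p with ⊔-sel (value (X Fin.zero) ω) (maximum (tabulate (λ i → value (X (Fin.suc i)) ω)))
        ... | inj₁ eq = inj₁ (subst (r <_) eq p)
        ... | inj₂ eq = inj₂ (subst (r <_) eq p)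

  -- Tails of a single random variable.

  Pr[>]≤1 : ∀ X r → Pr[ X > r ] ≤ 1#
  Pr[>]≤1 X r = Pr≤1 space (measurable r)
    where open RandomVariable X

  Pr[>]-antitone : ∀ X {r s} → r ≤ s → Pr[ X > s ] ≤ Pr[ X > r ]
  Pr[>]-antitone X r≤s = Pr-mono space (measurable _) (measurable _) (≤-<-trans r≤s)
    where open RandomVariable X

  -- The events above `r` and at most `r` are disjoint, and the second already carries the whole
  -- mass 1.
  Pr[>]≤0 : ∀ X {r} → AlmostSurely[ X ≤ r ] → Pr[ X > r ] ≤ 0#
  Pr[>]≤0 X {r} X≤r = +-cancelʳ-≤ 1# (begin
    Pr >r + 1#     ≡⟨ cong (Pr >r +_) X≤r ⟨
    Pr >r + Pr ≤r  ≡⟨ Pr-∪-disjoint space (measurable r) m≤r (λ { _ (p , q) → <⇒≱ p q }) ⟨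
    Pr (>r ∪ ≤r)   ≤⟨ Pr≤1 space (measurable-∪ space (measurable r) m≤r) ⟩
    1#             ≡⟨ +-identityˡ 1# ⟨
    0# + 1#        ∎)
    where
    open RandomVariable X
    >r ≤r : Pred Ω 0ℓ
    >r ω = value ω > r
    ≤r ω = value ω ≤ r
    m≤r : Measurable ≤r
    m≤r = measurable-≐ (≮⇒≥ , λ p q → <⇒≱ q p) (measurable-∁ (measurable r))

  x*y≤0⇒y≤0 : ∀ {x y} → 0# < x → x * y ≤ 0# → y ≤ 0#
  x*y≤0⇒y≤0 {x} {y} 0<x xy≤0 = begin
    y               ≡⟨ *-identityˡ y ⟨
    1# * y          ≡⟨ cong (_* y) (⁻¹-inverseˡ 0<x) ⟨
    x ⁻¹ * x * y    ≡⟨ *-assoc (x ⁻¹) x y ⟩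
    x ⁻¹ * (x * y)  ≤⟨ *-monoˡ-≤ (0<x⇒0≤x⁻¹ 0<x) xy≤0 ⟩
    x ⁻¹ * 0#       ≡⟨ zeroʳ (x ⁻¹) ⟩
    0#              ∎

  -- The union bound over the calls and the averaged recurrence.

  total-tabulate-≤ : ∀ {n} (g : ℝ → ℝ) (y : Vec ℝ n) (p : Fin n → ℝ) {k} →
                     (∀ i → p i ≤ g (lookup y i) * k) → total (tabulate p) ≤ total (map g y) * k
  total-tabulate-≤ g []      p {k} p≤ = ≤-reflexive (sym (zeroˡ k))
  total-tabulate-≤ g (x ∷ y) p {k} p≤ =
    ≤-trans (+-mono-≤ (p≤ Fin.zero) (total-tabulate-≤ g y (λ i → p (Fin.suc i)) (λ i → p≤ (Fin.suc i))))
            (≤-reflexive (sym (distribʳ k _ _)))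

  module _ {S : ℝ → RandomVariable} {n} .{{_ : NonZero n}} where

    -- `k` is the same for all calls, so it factors out of the union bound; the coupling enters
    -- through its marginals alone.
    Pr[max]≤total-map : ∀ (g : ℝ → ℝ) {y : Vec ℝ n} (C : Coupling S y) {t k} →
                        (∀ i → Pr[ S (lookup y i) > t ] ≤ g (lookup y i) * k) →
                        Pr[max_>_] S C t ≤ total (map g y) * k
    Pr[max]≤total-map g {y} C {t} p≤ =
      ≤-trans (proj₂ (Pr[max]≤total space var t))
              (total-tabulate-≤ g y _ (λ i → ≤-trans (≤-reflexive (marginal i t)) (p≤ i)))
      where open Coupling C

    -- The bound on the maximum is taken proportional to `maximum y` so that weighting by `mass y`
    -- and summing yields the expectation `e`.
    recurrence-≤ : ∀ {law : DiscreteLaw n} {b x e r c} →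
                   SatisfiesRecurrence S law b x → HasExpectation law maximum e → 0# ≤ c →
                   (∀ {y} → DiscreteLaw.Support law y → (C : Coupling S y) →
                     Pr[max_>_] S C (r - b) ≤ c * maximum y) →
                   Pr[ S x > r ] ≤ c * e
    recurrence-≤ {law} {b} {r = r} {c} (C , tail) expectation 0≤c max≤ =
      HasSum-scale-≤ 0≤c term-≤ (tail r) expectation
      where
      open DiscreteLaw law
      term-≤ : ∀ y → mass y * Pr[max_>_] S (C y) (r - b) ≤ c * (mass y * maximum y)
      term-≤ y with em {Support y}
      ... | yes 0<mass = ≤-trans (*-monoˡ-≤ (proj₁ 0<mass) (max≤ 0<mass (C y)))
              (≤-reflexive (solve 3 (λ a c M → a :* (c :* M) := c :* (a :* M)) refl _ _ _))
      -- Outside the support the mass is 0 and both sides vanish, whichever coupling `C y` is.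
      ... | no  mass≤0 = ≤-reflexive (trans (cong (_* _) mass≡0)
              (trans (zeroˡ _) (sym (trans (cong (λ a → c * (a * _)) mass≡0)
                (trans (cong (c *_) (zeroˡ _)) (zeroʳ c))))))
        where
        mass≡0 : mass y ≡ 0#
        mass≡0 = antisym (≮⇒≥ mass≤0) (mass-nonNeg y)

  -- The minimum of `u`.

  module _
    {b m u : ℝ → ℝ} {d} (0≤d : 0# ≤ d)
    (b-pos : ∀ x → x > d → b x > 0#)
    (m-range : ∀ x → x ≥ 0# → 0# ≤ m x × m x ≤ x)
    (u-rec : ∀ x → x ≥ 0# → u x ≡ b x + u (m x))
    (u-const : ∀ x → x ≥ 0# → x ≤ d → u x ≡ u d)
    (u-continuous : ContinuousOnNonNeg u)
    (b-nonNeg : ∀ x → x ≥ 0# → b x ≥ 0#)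
    where

    -- The sublevel set of u at u q is closed under m and, by continuity, has a
    -- least element a. Then m a = a, which b a > 0 forbids when a > d.
    u-minimum : ∀ q → 0# ≤ q → u d ≤ u q
    u-minimum q 0≤q with em {u d ≤ u q}
    ... | yes ud≤uq = ud≤uq
    ... | no  ud≰uq = ⊥-elim (proj₂ (b-pos a a>d) (sym ba≡0))
      where
      -- Completeness speaks of suprema, so the sublevel set is reflected through 0; its infimum `a`
      -- is then the negative of a supremum.
      Sublevel : Pred ℝ 0ℓ
      Sublevel s = s ≤ 0# × u (- s) ≤ u q

      sublevel : ∀ z → 0# ≤ z → u z ≤ u q → Sublevel (- z)
      sublevel z 0≤z uz≤uq =
        ≤-trans (neg-≤ 0≤z) (≤-reflexive -0#≈0#) , ≤-trans (≤-reflexive (cong u (-‿involutive z))) uz≤uq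

      supremum : ∃[ s ] IsSupremum Sublevel s
      supremum = complete Sublevel (- q , sublevel q 0≤q ≤-refl) (0# , λ _ → proj₁)

      s a : ℝ
      s = proj₁ supremum
      a = - s

      upper : UpperBound Sublevel s
      upper = proj₁ (proj₂ supremum)

      0≤-x : ∀ {x} → x ≤ 0# → 0# ≤ - x
      0≤-x x≤0 = ≤-trans (≤-reflexive (sym -0#≈0#)) (neg-≤ x≤0)

      0≤a : 0# ≤ a
      0≤a = 0≤-x (proj₂ (proj₂ supremum) 0# (λ _ → proj₁))

      a-least : ∀ z → 0# ≤ z → u z ≤ u q → a ≤ z
      a-least z 0≤z uz≤uq = ≤-trans (neg-≤ (upper (- z) (sublevel z 0≤z uz≤uq))) (≤-reflexive (-‿involutive z))

      -- Otherwise continuity with tolerance `u a - u q` keeps `u` above `u q` within distance `δ`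
      -- of `a`. Then `s - δ` would still bound the reflected set, although `s` is its least bound.
      ua≤uq : u a ≤ u q
      ua≤uq with em {u a ≤ u q}
      ... | yes p = p
      ... | no ua≰uq with u-continuous a 0≤a (u a - u q) (x<y⇒0<y-x (≰⇒> ua≰uq))
      ...   | δ , 0<δ , near = ⊥-elim (<⇒≱ 0<δ δ≤0)
        where
        s-δ-upper : UpperBound Sublevel (s - δ)
        s-δ-upper z z∈@(z≤0 , u-z≤uq) = ≮⇒≥ λ s-δ<z →
          <⇒≱ (near (- z) (0≤-x z≤0) (-z-near s-δ<z)) (begin
            u a - u q      ≤⟨ +-monoʳ-≤ (u a) (neg-≤ u-z≤uq) ⟩
            u a - u (- z)  ≡⟨ ⁻¹-anti-homo-// (u (- z)) (u a) ⟨
            - (u (- z) - u a) ≤⟨ x≤y⊔x _ _ ⟩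
            ∣ u (- z) - u a ∣ ∎)
          where
          z≤s : z ≤ s
          z≤s = upper z z∈
          -z-a≡s-z : - z - a ≡ s - z
          -z-a≡s-z = trans (cong (- z +_) (-‿involutive s)) (+-comm (- z) s)
          -z-near : s - δ < z → ∣ - z - a ∣ < δ
          -z-near s-δ<z = subst (λ v → ∣ v ∣ < δ) (sym -z-a≡s-z)
            (∣x∣<δ (≰⇒> λ δ≤s-z → <⇒≱ s-δ<z (x+y≤z⇒x≤z-y (≤-trans (≤-reflexive (+-comm z δ)) (x≤z-y⇒x+y≤z δ≤s-z))))
                   (≤-<-trans (≤-trans (neg-≤ (x≤y⇒0≤y-x z≤s)) (≤-reflexive -0#≈0#)) 0<δ))
        δ≤0 : δ ≤ 0#
        δ≤0 = +-cancelʳ-≤ s (begin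
          δ + s   ≡⟨ +-comm δ s ⟩
          s + δ   ≤⟨ x≤z-y⇒x+y≤z (proj₂ (proj₂ supremum) (s - δ) s-δ-upper) ⟩
          s       ≡⟨ +-identityˡ s ⟨
          0# + s  ∎)

      -- For `a ≤ d`, `u a` would equal `u d`, giving the excluded `u d ≤ u q`.
      a>d : a > d
      a>d = ≰⇒> λ a≤d → ud≰uq (≤-trans (≤-reflexive (sym (u-const a 0≤a a≤d))) ua≤uq)

      u∘m≤u : u (m a) ≤ u a
      u∘m≤u = begin
        u (m a)        ≡⟨ +-identityˡ (u (m a)) ⟨
        0# + u (m a)   ≤⟨ +-monoˡ-≤ (u (m a)) (b-nonNeg a 0≤a) ⟩
        b a + u (m a)  ≡⟨ u-rec a 0≤a ⟨
        u a            ∎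

      ma≡a : m a ≡ a
      ma≡a = antisym (proj₂ (m-range a 0≤a)) (a-least (m a) (proj₁ (m-range a 0≤a)) (≤-trans u∘m≤u ua≤uq))

      ba≡0 : b a ≡ 0#
      ba≡0 = begin-equality
        b a                ≡⟨ x+y-y≡x (b a) (u a) ⟨
        b a + u a - u a    ≡⟨ cong (λ v → b a + u v - u a) ma≡a ⟨
        b a + u (m a) - u a ≡⟨ cong (_- u a) (u-rec a 0≤a) ⟨
        u a - u a          ≡⟨ -‿inverseʳ (u a) ⟩
        0#                 ∎

  -- The tail bound by induction on the recursion depth.

  module _
    {n} .{{_ : NonZero n}} {d} (0≤d : d ≥ 0#)
    {h : ℝ → DiscreteLaw n}
    (h-range : ∀ x → x ≥ 0# → ∀ y → DiscreteLaw.Support (h x) y →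
      ∀ (i : Fin n) → 0# ≤ lookup y i × lookup y i ≤ x)
    {S : ℝ → RandomVariable} {b : ℝ → ℝ}
    (b-zero : ∀ x → x ≥ 0# → x ≤ d → b x ≡ 0#)
    (b-pos : ∀ x → x > d → b x > 0#)
    (recurrence : ∀ x → x > d → SatisfiesRecurrence S (h x) (b x) x)
    (terminates : ∀ x → x ≥ 0# → ∃[ k ] TerminatesWithin h d x k)
    {g : ℝ → ℝ}
    (g-nonNeg : ∀ x → g x ≥ 0#)
    (g≥1 : ∀ x → x > d → g x ≥ 1#)
    (g-total : ∀ x → x > d → ∀ y → DiscreteLaw.Support (h x) y → total (map g y) ≤ g x)
    {m : ℝ → ℝ}
    (mean : ∀ x → x ≥ 0# → ∃[ e ] (HasExpectation (h x) maximum e × e ≤ m x))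
    (m-range : ∀ x → x ≥ 0# → 0# ≤ m x × m x ≤ x)
    (m/x-mono : ∀ x y → x > 0# → x ≤ y → m x / x ≤ m y / y)
    {u : ℝ → ℝ}
    (u-rec : ∀ x → x ≥ 0# → u x ≡ b x + u (m x))
    (u-const : ∀ x → x ≥ 0# → x ≤ d → u x ≡ u d)
    (S≤u : ∀ x → x ≥ 0# → x ≤ d → AlmostSurely[ S x ≤ u x ])
    (u-continuous : ContinuousOnNonNeg u)
    (b-increasing : ∀ x y → x ≥ 0# → y ≥ 0# → b x > 0# → b y > 0# → x < y → b x < b y)
    where

    private
      ρ : ℝ → ℝ
      ρ x = m x / x

    >d⇒>0 : ∀ {x} → x > d → x > 0#
    >d⇒>0 = ≤-<-trans 0≤d

    >d⇒≥0 : ∀ {x} → x > d → x ≥ 0#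
    >d⇒≥0 x>d = proj₁ (>d⇒>0 x>d)

    b-nonNeg : ∀ x → x ≥ 0# → b x ≥ 0#
    b-nonNeg x 0≤x with ≤-<-connex x d
    ... | inj₁ x≤d = ≤-reflexive (sym (b-zero x 0≤x x≤d))
    ... | inj₂ x>d = proj₁ (b-pos x x>d)

    -- Strict growth of `b` is given only where `b` is positive; `x > d` puts `x`, hence also `y`,
    -- there.
    b-mono : ∀ {x y} → x > d → x ≤ y → b x ≤ b y
    b-mono {x} {y} x>d x≤y with em {x ≡ y}
    ... | yes refl = ≤-refl
    ... | no  x≢y  = proj₁ (b-increasing x y (>d⇒≥0 x>d) (>d⇒≥0 y>d) (b-pos x x>d) (b-pos y y>d) (x≤y , x≢y))
      where
      y>d : y > d
      y>d = <-≤-trans x>d x≤y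

    u≥ud : ∀ q → 0# ≤ q → u d ≤ u q
    u≥ud = u-minimum 0≤d b-pos m-range u-rec u-const u-continuous b-nonNeg

    ρ-nonNeg : ∀ {x} → x > 0# → 0# ≤ ρ x
    ρ-nonNeg {x} 0<x = *-nonNeg (proj₁ (m-range x (proj₁ 0<x))) (0<x⇒0≤x⁻¹ 0<x)

    ρ*x≡m : ∀ {x} → x > 0# → ρ x * x ≡ m x
    ρ*x≡m {x} 0<x = trans (*-assoc (m x) (x ⁻¹) x) (trans (cong (m x *_) (⁻¹-inverseˡ 0<x)) (*-identityʳ (m x)))

    -- `u` is constant on sizes up to `d`, so the almost sure bound on `S x` there is `u d`.
    tail-base : ∀ {x r} → 0# ≤ x → x ≤ d → u d ≤ r → Pr[ S x > r ] ≤ 0#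
    tail-base {x} 0≤x x≤d ud≤r =
      ≤-trans (Pr[>]-antitone (S x) (≤-trans (≤-reflexive (u-const x 0≤x x≤d)) ud≤r))
              (Pr[>]≤0 (S x) (S≤u x 0≤x x≤d))

    -- A chain of `k` calls from `z` becomes one of `suc k` calls from `x` once `x` is put in front.
    terminates-call : ∀ {x z k} → TerminatesWithin h d x (suc k) → Calls h x z → TerminatesWithin h d z k
    terminates-call {x} {z} {k} term call s s0≡z calls = term prepended refl calls′
      where
      prepended : ℕ → ℝ
      prepended zero    = x
      prepended (suc j) = s j
      calls′ : ∀ j → j ℕ.< suc k → Calls h (prepended j) (prepended (suc j))
      calls′ zero    _         = subst (Calls h x) (sym s0≡z) call
      calls′ (suc j) (s≤s j<k) = calls j j<k

    -- The hypothesis on the mean enters here: averaging `c * maximum y` gives `c * e`, and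
    -- `e ≤ m x`.
    tail-step : ∀ {x c r} → x > d → 0# ≤ c →
                (∀ {y} → DiscreteLaw.Support (h x) y → (C : Coupling S y) →
                  Pr[max_>_] S C (r - b x) ≤ c * maximum y) →
                Pr[ S x > r ] ≤ c * m x
    tail-step {x} x>d 0≤c max≤ with mean x (>d⇒≥0 x>d)
    ... | e , expectation , e≤m =
      ≤-trans (recurrence-≤ {law = h x} (recurrence x x>d) expectation 0≤c max≤) (*-monoˡ-≤ 0≤c e≤m)

    -- Serves the case `ρ q ≡ 0#`, in which `m q` has no reciprocal. A mean of at most 0 forces
    -- every maximum in the support to be at most 0, so all calls have size at most `d` and no tail
    -- above `u d`.
    tail-degenerate : ∀ {x r} → x > d → m x ≤ 0# → u d ≤ r - b x → Pr[ S x > r ] ≤ 0#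
    tail-degenerate {x} {r} x>d m≤0 ud≤t = ≤-trans (tail-step x>d ≤-refl max≤) (≤-reflexive (zeroˡ (m x)))
      where
      max≤ : ∀ {y} → DiscreteLaw.Support (h x) y → (C : Coupling S y) →
             Pr[max_>_] S C (r - b x) ≤ 0# * maximum y
      max≤ {y} supp C = ≤-trans (Pr[max]≤total-map g C each)
                                (≤-reflexive (trans (zeroʳ _) (sym (zeroˡ (maximum y)))))
        where
        open DiscreteLaw (h x) using (mass)
        max≤0 : maximum y ≤ 0#
        max≤0 with mean x (>d⇒≥0 x>d)
        ... | e , expectation , e≤m =
          -- The single term `mass y * maximum y` lies below the whole expectation, and the mass is
          -- positive on the support.
          x*y≤0⇒y≤0 supp (≤-trans (HasSum-term-≤ expectation y) (≤-trans e≤m m≤0))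
        each : ∀ i → Pr[ S (lookup y i) > r - b x ] ≤ g (lookup y i) * 0#
        each i = ≤-trans
          (tail-base (proj₁ (h-range x (>d⇒≥0 x>d) y supp i))
                     (≤-trans (lookup≤maximum y i) (≤-trans max≤0 0≤d)) ud≤t)
          (≤-reflexive (sym (zeroʳ _)))

    -- Enlarging each call size to `maximum y` gives all calls a common factor, so only the values
    -- of `g` are summed. The condition `u d ≤ r - b x` disposes of the calls that have stopped.
    tail-descend : ∀ {x K r k} → x > d → TerminatesWithin h d x (suc k) → 0# ≤ K → u d ≤ r - b x →
                   (∀ {z} → z > d → z ≤ x → TerminatesWithin h d z k → Pr[ S z > r - b x ] ≤ g z * (z * K)) →
                   Pr[ S x > r ] ≤ g x * (m x * K)
    tail-descend {x} {K} {r} x>d term 0≤K ud≤t tail-z =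
      ≤-trans (tail-step x>d (*-nonNeg (g-nonNeg x) 0≤K) max≤)
              (≤-reflexive (solve 3 (λ a c e → a :* c :* e := a :* (e :* c)) refl (g x) K (m x)))
      where
      max≤ : ∀ {y} → DiscreteLaw.Support (h x) y → (C : Coupling S y) →
             Pr[max_>_] S C (r - b x) ≤ g x * K * maximum y
      max≤ {y} supp C = begin
        Pr[max_>_] S C (r - b x)           ≤⟨ Pr[max]≤total-map g C each ⟩
        total (map g y) * (maximum y * K)  ≤⟨ *-monoʳ-≤ (*-nonNeg 0≤max 0≤K) (g-total x x>d y supp) ⟩
        g x * (maximum y * K)              ≡⟨ solve 3 (λ a c e → a :* (c :* e) := a :* e :* c) refl (g x) (maximum y) K ⟩
        g x * K * maximum y                ∎
        where
        range : ∀ i → 0# ≤ lookup y i × lookup y i ≤ x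
        range = h-range x (>d⇒≥0 x>d) y supp

        some : ∀ {n} .{{_ : NonZero n}} → Fin n
        some {zero}  = ⊥-elim (≢-nonZero⁻¹ 0 refl)
        some {suc n} = Fin.zero

        0≤max : 0# ≤ maximum y
        0≤max = ≤-trans (proj₁ (range some)) (lookup≤maximum y some)

        each : ∀ i → Pr[ S (lookup y i) > r - b x ] ≤ g (lookup y i) * (maximum y * K)
        each i with ≤-<-connex (lookup y i) d
        ... | inj₁ z≤d = ≤-trans (tail-base (proj₁ (range i)) z≤d ud≤t) (*-nonNeg (g-nonNeg _) (*-nonNeg 0≤max 0≤K))
        ... | inj₂ z>d = ≤-trans (tail-z z>d (proj₂ (range i)) (terminates-call term (y , supp , i , refl)))
                                 (*-monoˡ-≤ (g-nonNeg _) (*-monoʳ-≤ 0≤K (lookup≤maximum y i)))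

    -- The free point q makes the induction go through: in a recursive call of
    -- size z the same q serves with w decreased by one, and once w = 0 the point
    -- q is replaced by m q. The scalar κ stands for 1 / q.
    tail-bound : ∀ k {x} → x > d → TerminatesWithin h d x k →
                 ∀ w {q κ r} → 0# ≤ q → 0# ≤ κ → 1# ≤ κ * q → u q + w · b x ≤ r →
                 Pr[ S x > r ] ≤ g x * (x * (ρ x ^ w * κ))
    -- Depth 0 would mean `x ≤ d`, read off from the constant chain.
    tail-bound zero {x} x>d term = ⊥-elim (<⇒≱ x>d (term (λ _ → x) refl (λ _ ())))
    tail-bound (suc k) {x} x>d term (suc w) {q} {κ} {r} 0≤q 0≤κ 1≤κq level =
      ≤-trans (tail-descend x>d term (*-nonNeg 0≤ρ^w 0≤κ) ud≤t tail-z) (≤-reflexive regroup)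
      where
      x>0 : x > 0#
      x>0 = >d⇒>0 x>d
      0≤ρ^w : 0# ≤ ρ x ^ w
      0≤ρ^w = 0≤x^n (ρ-nonNeg x>0) w

      -- The toll uses up one of the `suc w` copies of `b x`; `w` copies remain for the calls.
      uq+w·b≤t : u q + w · b x ≤ r - b x
      uq+w·b≤t = x+y≤z⇒x≤z-y (≤-trans
        (≤-reflexive (solve 3 (λ a c e → a :+ c :+ e := a :+ (e :+ c)) refl (u q) (w · b x) (b x))) level)

      ud≤t : u d ≤ r - b x
      ud≤t = begin
        u d              ≡⟨ +-identityʳ (u d) ⟨
        u d + 0#         ≤⟨ +-mono-≤ (u≥ud q 0≤q) (0≤n·x w (b-nonNeg x (proj₁ x>0))) ⟩
        u q + w · b x    ≤⟨ uq+w·b≤t ⟩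
        r - b x          ∎

      -- Since `b z ≤ b x`, the level is high enough for `z` with `w` copies of its own toll;
      -- `ρ z ≤ ρ x` then makes the factor independent of `z`.
      tail-z : ∀ {z} → z > d → z ≤ x → TerminatesWithin h d z k →
               Pr[ S z > r - b x ] ≤ g z * (z * (ρ x ^ w * κ))
      tail-z {z} z>d z≤x term-z = ≤-trans
        (tail-bound k z>d term-z w 0≤q 0≤κ 1≤κq
          (≤-trans (+-monoʳ-≤ (u q) (·-monoʳ-≤ w (b-mono z>d z≤x))) uq+w·b≤t))
        (*-monoˡ-≤ (g-nonNeg z) (*-monoˡ-≤ (>d⇒≥0 z>d) (*-monoʳ-≤ 0≤κ
          (^-mono-≤ (ρ-nonNeg (>d⇒>0 z>d)) (m/x-mono z x (>d⇒>0 z>d) z≤x) w))))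

      -- `m x` is `ρ x * x`, which raises the exponent from `w` back to `suc w`.
      regroup : g x * (m x * (ρ x ^ w * κ)) ≡ g x * (x * (ρ x ^ suc w * κ))
      regroup = trans (cong (λ v → g x * (v * (ρ x ^ w * κ))) (sym (ρ*x≡m x>0)))
        (solve 5 (λ a p y s c → a :* (p :* y :* (s :* c)) := a :* (y :* (p :* s :* c))) refl
          (g x) (ρ x) x (ρ x ^ w) κ)
    tail-bound (suc k) {x} x>d term zero {q} {κ} {r} 0≤q 0≤κ 1≤κq level with ≤-<-connex q x
    -- As `κ * x ≥ κ * q ≥ 1#` and `g x ≥ 1#`, the claimed bound is at least 1. The factor `1#` is
    -- `ρ x ^ zero`.
    ... | inj₁ q≤x = begin
      Pr[ S x > r ]             ≤⟨ Pr[>]≤1 (S x) r ⟩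
      1#                        ≤⟨ g≥1 x x>d ⟩
      g x                       ≡⟨ *-identityʳ (g x) ⟨
      g x * 1#                  ≤⟨ *-monoˡ-≤ (g-nonNeg x) (≤-trans 1≤κq (*-monoˡ-≤ 0≤κ q≤x)) ⟩
      g x * (κ * x)             ≡⟨ cong (g x *_) (trans (*-comm κ x) (cong (x *_) (sym (*-identityˡ κ)))) ⟩
      g x * (x * (1# * κ))      ∎
    ... | inj₂ x<q = result
      where
      x>0 : x > 0#
      x>0 = >d⇒>0 x>d
      q>d : q > d
      q>d = <-≤-trans x>d (proj₁ x<q)
      q>0 : q > 0#
      q>0 = >d⇒>0 q>d
      0≤mq : 0# ≤ m q
      0≤mq = proj₁ (m-range q 0≤q)
      0≤RHS : 0# ≤ g x * (x * (1# * κ))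
      0≤RHS = *-nonNeg (g-nonNeg x) (*-nonNeg (proj₁ x>0) (*-nonNeg 0≤1 0≤κ))

      -- By `b x ≤ b q`, the level left after the toll is at least `u q - b q`, which the recurrence
      -- for `u` identifies with `u (m q)`.
      u[mq]≤t : u (m q) ≤ r - b x
      u[mq]≤t = x+y≤z⇒x≤z-y (begin
        u (m q) + b x  ≤⟨ +-monoʳ-≤ (u (m q)) (b-mono x>d (proj₁ x<q)) ⟩
        u (m q) + b q  ≡⟨ +-comm (u (m q)) (b q) ⟩
        b q + u (m q)  ≡⟨ u-rec q 0≤q ⟨
        u q            ≡⟨ +-identityʳ (u q) ⟨
        u q + 0#       ≤⟨ level ⟩
        r              ∎)

      ud≤t : u d ≤ r - b x
      ud≤t = ≤-trans (u≥ud (m q) 0≤mq) u[mq]≤t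

      mx≤ρq*x : m x ≤ ρ q * x
      mx≤ρq*x = ≤-trans (≤-reflexive (sym (ρ*x≡m x>0))) (*-monoʳ-≤ (proj₁ x>0) (m/x-mono x q x>0 (proj₁ x<q)))

      result : Pr[ S x > r ] ≤ g x * (x * (1# * κ))
      -- The new scalar divides by `ρ q`, so a zero value is treated apart; it makes `m x ≤ ρ q * x`
      -- vanish.
      result with em {0# ≡ ρ q}
      ... | yes 0≡ρq = ≤-trans (tail-degenerate x>d mx≤0 ud≤t) 0≤RHS
        where
        mx≤0 : m x ≤ 0#
        mx≤0 = ≤-trans mx≤ρq*x (≤-reflexive (trans (cong (_* x) (sym 0≡ρq)) (zeroˡ x)))
      ... | no 0≢ρq = begin
        Pr[ S x > r ]              ≤⟨ tail-descend x>d term (*-nonNeg 0≤1 0≤κ′) ud≤t tail-z ⟩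
        -- Bounding `m x` by `ρ q * x` cancels the reciprocal of `ρ q` inside `κ′` and restores `κ`.
        g x * (m x * (1# * κ′))    ≤⟨ *-monoˡ-≤ (g-nonNeg x) (*-monoʳ-≤ (*-nonNeg 0≤1 0≤κ′) mx≤ρq*x) ⟩
        g x * (ρ q * x * (1# * κ′)) ≡⟨ solve 6 (λ a p y o c i → a :* (p :* y :* (o :* (c :* i))) := a :* (y :* (o :* c) :* (i :* p)))
                                        refl (g x) (ρ q) x 1# κ (ρ q ⁻¹) ⟩
        g x * (x * (1# * κ) * (ρ q ⁻¹ * ρ q)) ≡⟨ cong (g x *_) (trans (cong (x * (1# * κ) *_) (⁻¹-inverseˡ 0<ρq)) (*-identityʳ _)) ⟩
        g x * (x * (1# * κ))       ∎
        where
        0<ρq : 0# < ρ q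
        0<ρq = ρ-nonNeg q>0 , 0≢ρq
        -- Plays for `m q` the part that `κ` plays for `q`: `κ′ * m q` equals `κ * q`, hence is at
        -- least 1.
        κ′ : ℝ
        κ′ = κ * ρ q ⁻¹
        0≤κ′ : 0# ≤ κ′
        0≤κ′ = *-nonNeg 0≤κ (0<x⇒0≤x⁻¹ 0<ρq)
        κ′*mq≡κ*q : κ′ * m q ≡ κ * q
        κ′*mq≡κ*q = begin-equality
          κ′ * m q                    ≡⟨ cong (κ′ *_) (ρ*x≡m q>0) ⟨
          κ * ρ q ⁻¹ * (ρ q * q)      ≡⟨ solve 4 (λ c i p y → c :* i :* (p :* y) := c :* y :* (i :* p)) refl κ (ρ q ⁻¹) (ρ q) q ⟩
          κ * q * (ρ q ⁻¹ * ρ q)      ≡⟨ cong (κ * q *_) (⁻¹-inverseˡ 0<ρq) ⟩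
          κ * q * 1#                  ≡⟨ *-identityʳ (κ * q) ⟩
          κ * q                       ∎
        tail-z : ∀ {z} → z > d → z ≤ x → TerminatesWithin h d z k →
                 Pr[ S z > r - b x ] ≤ g z * (z * (1# * κ′))
        tail-z z>d _ term-z = tail-bound k z>d term-z zero 0≤mq 0≤κ′
          (≤-trans 1≤κq (≤-reflexive (sym κ′*mq≡κ*q)))
          (≤-trans (≤-reflexive (+-identityʳ (u (m q)))) u[mq]≤t)

    -- Sizes up to `d` have no tail at this level, since `u d` is the minimum of `u` and `b` is
    -- non-negative. Above `d`, the choice of `x` for `q` and `x ⁻¹` for `κ` cancels the factor `x`
    -- in `tail-bound`.
    tail-conclusion : ∀ w x → x > 0# → Pr[ S x > u x + w · b x ] ≤ g x * (m x / x) ^ w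
    tail-conclusion w x x>0 with ≤-<-connex x d
    ... | inj₁ x≤d = ≤-trans
      (tail-base (proj₁ x>0) x≤d (≤-trans (≤-reflexive (sym (+-identityʳ (u d))))
        (+-mono-≤ (u≥ud x (proj₁ x>0)) (0≤n·x w (b-nonNeg x (proj₁ x>0))))))
      (*-nonNeg (g-nonNeg x) (0≤x^n (ρ-nonNeg x>0) w))
    ... | inj₂ x>d = ≤-trans
      (tail-bound (proj₁ k) x>d (proj₂ k) w (proj₁ x>0) (0<x⇒0≤x⁻¹ x>0)
        (≤-reflexive (sym (⁻¹-inverseˡ x>0))) ≤-refl)
      (≤-reflexive (trans
        (solve 4 (λ a y p i → a :* (y :* (p :* i)) := a :* p :* (i :* y)) refl (g x) x (ρ x ^ w) (x ⁻¹))
        (trans (cong (g x * ρ x ^ w *_) (⁻¹-inverseˡ x>0)) (*-identityʳ _))))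
      where
      k : ∃[ k ] TerminatesWithin h d x k
      k = terminates x (proj₁ x>0)

theorem3 :
  (∀ {ℓ} → ExcludedMiddle ℓ) →
  (reals : RealNumbers) →
  let open Probability reals
      open DiscreteLaw in
  (n : ℕ) .{{_ : NonZero n}} →
  (d : ℝ) → d ≥ 0# →
  -- the recurrence
  (h : ℝ → DiscreteLaw n) →
  (∀ x → x ≥ 0# → ∀ y → Support (h x) y →
    ∀ (i : Fin n) → 0# ≤ lookup y i × lookup y i ≤ x) →
  (S : ℝ → RandomVariable) →
  (b : ℝ → ℝ) →
  (∀ x → x ≥ 0# → x ≤ d → b x ≡ 0#) →
  (∀ x → x > d → b x > 0#) →
  (∀ x → x > d → SatisfiesRecurrence S (h x) (b x) x) →
  (∀ x → x ≥ 0# → ∃[ k ] TerminatesWithin h d x k) →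
  -- the function g₁
  (g₁ : ℝ → ℝ) →
  (∀ x → g₁ x ≥ 0#) →
  (∀ x y → x ≤ y → g₁ x ≤ g₁ y) →
  (∀ x → x > d → g₁ x ≥ 1#) →
  (∀ x → x > d → ∀ y → Support (h x) y → total (map g₁ y) ≤ g₁ x) →
  -- the function m
  (m : ℝ → ℝ) →
  (∀ x → x ≥ 0# → ∃[ e ] (HasExpectation (h x) maximum e × e ≤ m x)) →
  (∀ x → x ≥ 0# → 0# ≤ m x × m x ≤ x) →
  (∀ x y → x > 0# → x ≤ y → m x / x ≤ m y / y) →
  -- the function u
  (u : ℝ → ℝ) →
  (∀ x → x ≥ 0# → u x ≡ b x + u (m x)) →
  (∀ x → x ≥ 0# → x ≤ d → u x ≡ u d) →
  (∀ x → x ≥ 0# → x ≤ d → AlmostSurely[ S x ≤ u x ]) →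
  -- regularity
  ContinuousOnNonNeg b →
  ContinuousOnNonNeg u →
  (∀ x y → x ≥ 0# → y ≥ 0# → b x > 0# → b y > 0# → x < y → b x < b y) →
  -- conclusion
  ∀ (w : ℕ) → w ℕ.≥ 1 → ∀ x → x > 0# → g₁ x ≥ 1# →
  Pr[ S x > u x + w · b x ] ≤ g₁ x * (m x / x) ^ w
theorem3 em reals n d 0≤d h h-range S b b-zero b-pos recurrence terminates
  g₁ g₁-nonNeg _ g₁≥1 g₁-total m mean m-range m/x-mono u u-rec u-const S≤u
  _ u-continuous b-increasing w _ x x>0 _ =
  tail-conclusion em reals 0≤d {h = h} h-range b-zero b-pos recurrence terminates
    g₁-nonNeg g₁≥1 g₁-total mean m-range m/x-mono u-rec u-const S≤u
    u-continuous b-increasing w x x>0
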